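{- Let $p$ be a prime number and $k$ be a positive integer. Then $$|\nu_{p^k}| = k+\sum_{i=1}^{k}\sum_{j=1}^{p^i-1}\phi(j).$$ In particular, $|\nu_p| = 1+\sum_{j=1}^{p-1}\phi(j)$.
   Context: For a positive integer $n$, elements of $\mathbb{Z}_n$ are identified with their representatives $0,1,\dots,n-1$. An unordered pair $\{a,b\}$ with $0\le a,b<n$ ($a=b$ allowed) is called a gcd-pair in $\mathbb{Z}_n$ if $\gcd(a,b)$ divides $n$. Here $\gcd(0,a)=a$ and $\gcd(0,0)=0$, so $\{0,0\}$ is not a gcd-pair. $\nu_n$ denotes the set of all gcd-pairs in $\mathbb{Z}_n$. $\phi$ is Euler's totient function. -}

module Defs where

open import Data.Fin.Base using (Fin; toℕ)
open import Data.List.Base using (applyUpTo; filter; length)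
open import Data.Nat.Base using (ℕ; suc)
open import Data.Nat.Coprimality using (coprime?)
open import Data.Nat.Divisibility using (_∣_)
open import Data.Nat.GCD using (gcd)
open import Data.Nat.ListAction using (sum)
open import Data.Product.Base using (Σ; _×_; _,_; proj₁)
open import Data.Sum.Base using (_⊎_; inj₁; inj₂)
open import Function.Base using (_∘_)
open import Function.Bundles using (Inverse)
open import Level using (Level; _⊔_; 0ℓ)
open import Relation.Binary.Bundles using (Setoid)
open import Relation.Binary.Core using (Rel)
open import Relation.Binary.Structures using (IsEquivalence)
open import Relation.Binary.PropositionalEquality
  using (_≡_; refl; sym; trans; setoid)
import Relation.Binary.Construct.On as On

-- ∑[1⋯ n ] f  is  f 1 + f 2 + ⋯ + f n  (and 0 when n = 0).
∑[1⋯_] : ℕ → (ℕ → ℕ) → ℕ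
∑[1⋯ n ] f = sum (applyUpTo (f ∘ suc) n)

-- The number of i in {1, …, n} coprime to n.
φ : ℕ → ℕ
φ n = length (filter (λ i → coprime? i n) (applyUpTo suc n))

-- An unordered pair {a , b}, with a = b allowed, is represented by the ordered
-- pairs (a , b) and (b , a), which are identified by the setoid equality.
_≈ᵤ_ : {A : Set} → Rel (A × A) 0ℓ
(a , b) ≈ᵤ (c , d) = (a ≡ c × b ≡ d) ⊎ (a ≡ d × b ≡ c)

≈ᵤ-isEquivalence : {A : Set} → IsEquivalence (_≈ᵤ_ {A})
≈ᵤ-isEquivalence {A} = record
  { refl  = inj₁ (refl , refl)
  ; sym   = symᵤ
  ; trans = transᵤ
  }
  where
  symᵤ : {x y : A × A} → x ≈ᵤ y → y ≈ᵤ x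
  symᵤ (inj₁ (p , q)) = inj₁ (sym p , sym q)
  symᵤ (inj₂ (p , q)) = inj₂ (sym q , sym p)

  transᵤ : {x y z : A × A} → x ≈ᵤ y → y ≈ᵤ z → x ≈ᵤ z
  transᵤ (inj₁ (p , q)) (inj₁ (r , s)) = inj₁ (trans p r , trans q s)
  transᵤ (inj₁ (p , q)) (inj₂ (r , s)) = inj₂ (trans p r , trans q s)
  transᵤ (inj₂ (p , q)) (inj₁ (r , s)) = inj₂ (trans p s , trans q r)
  transᵤ (inj₂ (p , q)) (inj₂ (r , s)) = inj₁ (trans p s , trans q r)

UnorderedPair : Set → Setoid 0ℓ 0ℓ
UnorderedPair A = record { isEquivalence = ≈ᵤ-isEquivalence {A} }

-- An element of Fin n is the representative in {0, …, n - 1} of a residue class.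
-- Here gcd 0 a = a and gcd 0 0 = 0, and 0 ∣ n only when n = 0.
IsGcdPair : (n : ℕ) → Fin n × Fin n → Set
IsGcdPair n (a , b) = gcd (toℕ a) (toℕ b) ∣ n

-- The equality of ν n ignores the divisibility proof.
ν : ℕ → Setoid 0ℓ 0ℓ
ν n = On.setoid {B = Σ (Fin n × Fin n) (IsGcdPair n)} (UnorderedPair (Fin n)) proj₁

HasCardinality : {a ℓ : Level} → Setoid a ℓ → ℕ → Set (a ⊔ ℓ)
HasCardinality S m = Inverse S (setoid (Fin m))

{-# OPTIONS --safe #-}
-- Sort each gcd-pair {a , b} as a ≤ b < pᵏ. A divisor of pᵏ⁺¹ is 1 or a
-- multiple of p, so a sorted gcd-pair in ℤ/pᵏ⁺¹ is either coprime or p times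
-- a sorted gcd-pair in ℤ/pᵏ. The coprime pairs are (0 , 1) together with
-- φ b pairs 1 ≤ a ≤ b for each 1 ≤ b < pᵏ⁺¹.
module Submission where

open import Defs
open import Data.Fin.Base using (Fin; toℕ; fromℕ<) renaming (zero to fzero; suc to fsuc)
open import Data.Fin.Properties using (toℕ<n; toℕ-fromℕ<; toℕ-injective)
open import Data.List.Base
  using (List; []; _∷_; _++_; [_]; map; concat; filter; length; lookup; applyUpTo)
open import Data.List.Membership.Propositional using (_∈_)
open import Data.List.Membership.Propositional.Properties
  using ( ∈-map⁺; ∈-map⁻; ∈-++⁺ˡ; ∈-++⁺ʳ; ∈-++⁻; ∈-concat⁺′; ∈-concat⁻′
        ; ∈-applyUpTo⁺; ∈-applyUpTo⁻; ∈-filter⁺; ∈-filter⁻; ∈-lookup)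
open import Data.List.Properties using (length-++; length-map; applyUpTo-∷ʳ)
open import Data.List.Relation.Binary.Disjoint.Propositional using (Disjoint)
import Data.List.Relation.Unary.All as All
import Data.List.Relation.Unary.All.Properties as All
open import Data.List.Relation.Unary.AllPairs using ([]; _∷_)
import Data.List.Relation.Unary.AllPairs.Properties as AllPairs
open import Data.List.Relation.Unary.Any using (here; there; index)
open import Data.List.Relation.Unary.Any.Properties using (lookup-index)
open import Data.List.Relation.Unary.Unique.Propositional using (Unique)
import Data.List.Relation.Unary.Unique.Propositional.Properties as Unique
open import Data.Nat.Base
  using (ℕ; zero; suc; _+_; _*_; _∸_; _^_; _⊓_; _⊔_; _≤_; _<_; z≤n; s≤s; NonZero; nonTrivial⇒n>1)
open import Data.Nat.Coprimality as Coprimality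
  using (Coprime; coprime?; coprime-divisor; coprime⇒gcd≡1; gcd≡1⇒coprime)
open import Data.Nat.Divisibility
  using (_∣_; divides; _∣?_; 1∣_; ∣1⇒≡1; ∣-trans; m∣m*n; *-monoʳ-∣; *-cancelˡ-∣)
open import Data.Nat.GCD
  using (gcd; gcd-comm; gcd[m,n]∣m; gcd[m,n]∣n; c*gcd[m,n]≡gcd[cm,cn])
open import Data.Nat.ListAction using (sum)
open import Data.Nat.ListAction.Properties using (sum-++)
open import Data.Nat.Primality
  using (Prime; ¬prime[1]; prime⇒nonZero; prime⇒irreducible; prime⇒nonTrivial)
open import Data.Nat.Properties
open import Data.Product.Base using (Σ; ∃; _×_; _,_; proj₁; proj₂)
open import Data.Sum.Base using (_⊎_; inj₁; inj₂)
open import Function.Base using (_∘_)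
open import Level using (Level)
open import Relation.Binary.Bundles using (Setoid)
open import Relation.Binary.PropositionalEquality
  using (_≡_; _≢_; _≗_; refl; sym; trans; cong; cong₂; subst; module ≡-Reasoning)
open import Relation.Nullary.Decidable using (yes; no)
open import Relation.Nullary.Negation using (¬_; contradiction)

-- Counting a setoid with a duplicate-free list.

private
  variable
    a b ℓ : Level
    A : Set a
    B : Set b

lookup-injective : {xs : List A} → Unique xs → ∀ {i j} → lookup xs i ≡ lookup xs j → i ≡ j
lookup-injective (_  ∷ _)  {fzero}  {fzero}  _  = refl
lookup-injective (x∉ ∷ _)  {fzero}  {fsuc j} eq = contradiction eq (All.lookup x∉ (∈-lookup j))
lookup-injective (x∉ ∷ _)  {fsuc i} {fzero}  eq = contradiction (sym eq) (All.lookup x∉ (∈-lookup i))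
lookup-injective (_  ∷ xs) {fsuc i} {fsuc j} eq = cong fsuc (lookup-injective xs eq)

-- Here `f` is a complete invariant for the setoid equality, so an element can be sent to the
-- position of its invariant in `ys`.
hasCardinality-by-image :
  (S : Setoid a ℓ) (f : Setoid.Carrier S → B) {ys : List B} →
  (∀ {x y} → Setoid._≈_ S x y → f x ≡ f y) → (∀ {x y} → f x ≡ f y → Setoid._≈_ S x y) →
  Unique ys → (∀ x → f x ∈ ys) → (∀ {y} → y ∈ ys → ∃ λ x → f x ≡ y) →
  HasCardinality S (length ys)
hasCardinality-by-image S f {ys} f-cong f-injective ys! image⊆ys ys⊆image = record
  { to        = to
  ; from      = from
  ; to-cong   = to-cong
  ; from-cong = λ { refl → Setoid.refl S }
  ; inverse   =
      (λ {i} x≈from → lookup-injective ys! (trans (lookup-to _) (trans (f-cong x≈from) (f-from i))))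
    , (λ { {x} refl → f-injective (trans (f-from (to x)) (lookup-to x)) })
  }
  where
  open Setoid S using (Carrier; _≈_)

  to : Carrier → Fin (length ys)
  to x = index (image⊆ys x)

  from : Fin (length ys) → Carrier
  from i = proj₁ (ys⊆image (∈-lookup i))

  lookup-to : ∀ x → lookup ys (to x) ≡ f x
  lookup-to x = sym (lookup-index (image⊆ys x))

  f-from : ∀ i → f (from i) ≡ lookup ys i
  f-from i = proj₂ (ys⊆image (∈-lookup i))

  to-cong : ∀ {x y} → x ≈ y → to x ≡ to y
  -- The membership proofs for `x` and `y` are unrelated; the positions agree because `ys` has no
  -- repeated entry.
  to-cong x≈y = lookup-injective ys! (trans (lookup-to _) (trans (f-cong x≈y) (sym (lookup-to _))))

-- Sorted representatives of unordered pairs.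

sort : ℕ × ℕ → ℕ × ℕ
sort (a , b) = a ⊓ b , a ⊔ b

sort-≤ : ∀ {a b} → a ≤ b → sort (a , b) ≡ (a , b)
sort-≤ a≤b = cong₂ _,_ (m≤n⇒m⊓n≡m a≤b) (m≤n⇒m⊔n≡n a≤b)

sort-swap : ∀ a b → sort (a , b) ≡ sort (b , a)
sort-swap a b = cong₂ _,_ (⊓-comm a b) (⊔-comm a b)

sort-cong : ∀ {x y} → x ≈ᵤ y → sort x ≡ sort y
sort-cong             (inj₁ (refl , refl)) = refl
sort-cong {x = a , b} (inj₂ (refl , refl)) = sort-swap a b

≈ᵤ-sort : ∀ x → x ≈ᵤ sort x
≈ᵤ-sort (a , b) with ≤-total a b
... | inj₁ a≤b = inj₁ (sym (m≤n⇒m⊓n≡m a≤b) , sym (m≤n⇒m⊔n≡n a≤b))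
... | inj₂ b≤a = inj₂ (sym (m≥n⇒m⊔n≡m b≤a) , sym (m≥n⇒m⊓n≡n b≤a))

-- Each pair represents the same unordered pair as its sorted form, so equal sorted forms link `x`
-- to `y`.
sort-injective : ∀ {x y} → sort x ≡ sort y → x ≈ᵤ y
sort-injective {x} {y} eq =
  ≈ᵤ.trans (≈ᵤ-sort x) (≈ᵤ.trans (≈ᵤ.reflexive eq) (≈ᵤ.sym (≈ᵤ-sort y)))
  where module ≈ᵤ = Setoid (UnorderedPair ℕ)

gcd-sort : ∀ a b → gcd (a ⊓ b) (a ⊔ b) ≡ gcd a b
gcd-sort a b with ≈ᵤ-sort (a , b)
... | inj₁ (p , q) = sym (cong₂ gcd p q)
... | inj₂ (p , q) = trans (gcd-comm (a ⊓ b) (a ⊔ b)) (sym (cong₂ gcd p q))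

SortedGcdPair : ℕ → ℕ × ℕ → Set
SortedGcdPair n (a , b) = a ≤ b × b < n × gcd a b ∣ n

-- The sorted pair of representatives is the complete invariant. This reduces the count to listing
-- pairs of natural numbers, free of `Fin`.
ν-cardinality : ∀ n {xs} → Unique xs → (∀ {x} → SortedGcdPair n x → x ∈ xs) →
                (∀ {x} → x ∈ xs → SortedGcdPair n x) → HasCardinality (ν n) (length xs)
ν-cardinality n {xs} xs! complete sound =
  hasCardinality-by-image (ν n) (sort ∘ values ∘ proj₁)
    (λ x≈y → sort-cong (values-cong x≈y)) (λ eq → values-injective (sort-injective eq))
    xs! image⊆xs xs⊆image
  where
  values : Fin n × Fin n → ℕ × ℕ
  values (a , b) = toℕ a , toℕ b

  values-cong : ∀ {x y} → x ≈ᵤ y → values x ≈ᵤ values y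
  values-cong (inj₁ (p , q)) = inj₁ (cong toℕ p , cong toℕ q)
  values-cong (inj₂ (p , q)) = inj₂ (cong toℕ p , cong toℕ q)

  values-injective : ∀ {x y} → values x ≈ᵤ values y → x ≈ᵤ y
  values-injective (inj₁ (p , q)) = inj₁ (toℕ-injective p , toℕ-injective q)
  values-injective (inj₂ (p , q)) = inj₂ (toℕ-injective p , toℕ-injective q)

  image⊆xs : ∀ (x : Σ (Fin n × Fin n) (IsGcdPair n)) → sort (values (proj₁ x)) ∈ xs
  image⊆xs ((a , b) , g∣n) = complete
    ( m⊓n≤m⊔n (toℕ a) (toℕ b)
    , ⊔-lub (toℕ<n a) (toℕ<n b)
    , subst (_∣ n) (sym (gcd-sort (toℕ a) (toℕ b))) g∣n )

  xs⊆image : ∀ {y} → y ∈ xs →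
             ∃ λ (x : Σ (Fin n × Fin n) (IsGcdPair n)) → sort (values (proj₁ x)) ≡ y
  xs⊆image {a , b} y∈xs with a≤b , b<n , g∣n ← sound y∈xs =
    -- A listed pair is already sorted, so its own entries give a preimage.
    ((fromℕ< a<n , fromℕ< b<n) , subst (_∣ n) (sym (cong₂ gcd toℕ-a toℕ-b)) g∣n)
    , trans (cong sort (cong₂ _,_ toℕ-a toℕ-b)) (sort-≤ a≤b)
    where
    a<n   = ≤-<-trans a≤b b<n
    toℕ-a = toℕ-fromℕ< a<n
    toℕ-b = toℕ-fromℕ< b<n

-- Enumeration of sorted coprime pairs.

totatives : ℕ → List ℕ
totatives n = filter (λ i → coprime? i n) (applyUpTo suc n)

-- Shifted to suc b so that ∑[1⋯ m ] φ matches applyUpTo, which counts from 0.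
coprimesTo1+ : ℕ → List (ℕ × ℕ)
coprimesTo1+ b = map (_, suc b) (totatives (suc b))

positiveCoprimePairs : ℕ → List (ℕ × ℕ)
positiveCoprimePairs m = concat (applyUpTo coprimesTo1+ m)

coprimePairs : ℕ → List (ℕ × ℕ)
coprimePairs m = (0 , 1) ∷ positiveCoprimePairs m

length-concat-applyUpTo : ∀ (f : ℕ → List A) m →
                          length (concat (applyUpTo f m)) ≡ sum (applyUpTo (length ∘ f) m)
length-concat-applyUpTo f zero    = refl
length-concat-applyUpTo f (suc m) =
  trans (length-++ (f 0)) (cong (length (f 0) +_) (length-concat-applyUpTo (f ∘ suc) m))

sum-applyUpTo-cong : ∀ {f g : ℕ → ℕ} → f ≗ g → ∀ m → sum (applyUpTo f m) ≡ sum (applyUpTo g m)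
sum-applyUpTo-cong f≗g zero    = refl
sum-applyUpTo-cong f≗g (suc m) = cong₂ _+_ (f≗g 0) (sum-applyUpTo-cong (f≗g ∘ suc) m)

-- `length (totatives n)` is `φ n` by definition, and the extra 1 counts `(0 , 1)`.
length-coprimePairs : ∀ m → length (coprimePairs m) ≡ 1 + ∑[1⋯ m ] φ
length-coprimePairs m = cong suc
  (trans (length-concat-applyUpTo coprimesTo1+ m)
         (sum-applyUpTo-cong (λ b → length-map (_, suc b) (totatives (suc b))) m))

∈-coprimesTo1+⁻ : ∀ b {x} → x ∈ coprimesTo1+ b →
                  ∃ λ i → x ≡ (suc i , suc b) × i < suc b × Coprime (suc i) (suc b)
∈-coprimesTo1+⁻ b x∈
  with _ , i∈ , refl ← ∈-map⁻ (_, suc b) x∈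
  with i∈′ , coprime ← ∈-filter⁻ (λ i → coprime? i (suc b)) {xs = applyUpTo suc (suc b)} i∈
  with i , i<1+b , refl ← ∈-applyUpTo⁻ suc i∈′
  = i , refl , i<1+b , coprime

-- The bound `0 < a` is what keeps these pairs apart from `(0 , 1)` in `coprimePairs-unique`.
∈-positiveCoprimePairs⁻ : ∀ m {a b} → (a , b) ∈ positiveCoprimePairs m →
                          0 < a × a ≤ b × b ≤ m × Coprime a b
∈-positiveCoprimePairs⁻ m x∈
  with _ , x∈row , row∈ ← ∈-concat⁻′ (applyUpTo coprimesTo1+ m) x∈
  with b , b<m , refl ← ∈-applyUpTo⁻ coprimesTo1+ row∈
  with i , refl , i<1+b , coprime ← ∈-coprimesTo1+⁻ b x∈row
  = s≤s z≤n , i<1+b , b<m , coprime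

∈-coprimePairs⁻ : ∀ {m a b} → 1 ≤ m → (a , b) ∈ coprimePairs m → a ≤ b × b ≤ m × Coprime a b
∈-coprimePairs⁻     1≤m (here refl) = z≤n , 1≤m , Coprimality.sym (Coprimality.1-coprimeTo 0)
∈-coprimePairs⁻ {m} 1≤m (there x∈)  = proj₂ (∈-positiveCoprimePairs⁻ m x∈)

∈-coprimePairs⁺ : ∀ {m a b} → a ≤ b → b ≤ m → Coprime a b → (a , b) ∈ coprimePairs m
∈-coprimePairs⁺ {a = zero} _ _ coprime
  -- Every number divides 0, so `b` is a common divisor and must be 1.
  with refl ← Coprimality.0-coprimeTo-m⇒m≡1 coprime = here refl
∈-coprimePairs⁺ {a = suc a} {b = suc b} a≤b b≤m coprime = there
  -- As `i < n` unfolds to `suc i ≤ n`, the two inequalities are already the bounds on the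
  -- zero-based indices `a` and `b`.
  (∈-concat⁺′ (∈-map⁺ (_, suc b) (∈-filter⁺ (λ i → coprime? i (suc b)) (∈-applyUpTo⁺ suc a≤b) coprime))
              (∈-applyUpTo⁺ coprimesTo1+ b≤m))

-- Rows differ in the second entry, and pairs within a row differ in the first.
coprimePairs-unique : ∀ m → Unique (coprimePairs m)
coprimePairs-unique m = All.tabulate 0,1∉ ∷ Unique.concat⁺
  (All.applyUpTo⁺₂ coprimesTo1+ m row-unique)
  (AllPairs.applyUpTo⁺₁ coprimesTo1+ m (λ i<j _ → rows-disjoint (<⇒≢ i<j)))
  where
  0,1∉ : ∀ {x} → x ∈ positiveCoprimePairs m → (0 , 1) ≢ x
  0,1∉ x∈ refl with () ← proj₁ (∈-positiveCoprimePairs⁻ m x∈)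

  row-unique : ∀ b → Unique (coprimesTo1+ b)
  row-unique b = Unique.map⁺ (cong proj₁) (Unique.filter⁺ (λ i → coprime? i (suc b))
    (Unique.applyUpTo⁺₁ suc (suc b) (λ i<j _ → <⇒≢ i<j ∘ suc-injective)))

  rows-disjoint : ∀ {i j} → i ≢ j → Disjoint (coprimesTo1+ i) (coprimesTo1+ j)
  rows-disjoint {i} {j} i≢j (x∈i , x∈j)
    with _ , refl , _ ← ∈-coprimesTo1+⁻ i x∈i
    with _ , refl , _ ← ∈-coprimesTo1+⁻ j x∈j = i≢j refl

-- The sum unfolds from its first term, while the induction on the exponent adds a last one.
∑-snoc : ∀ f n → ∑[1⋯ suc n ] f ≡ ∑[1⋯ n ] f + f (suc n)
∑-snoc f n = begin
  sum (applyUpTo (f ∘ suc) (suc n))               ≡⟨ cong sum (applyUpTo-∷ʳ (f ∘ suc) n) ⟨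
  sum (applyUpTo (f ∘ suc) n ++ [ f (suc n) ])    ≡⟨ sum-++ (applyUpTo (f ∘ suc) n) _ ⟩
  ∑[1⋯ n ] f + (f (suc n) + 0)                    ≡⟨ cong (∑[1⋯ n ] f +_) (+-identityʳ _) ⟩
  ∑[1⋯ n ] f + f (suc n)                          ∎
  where open ≡-Reasoning

-- Recursion on the exponent of a prime power.

module _ {p : ℕ} (p-prime : Prime p) where

  private instance
    p≢0 : NonZero p
    p≢0 = prime⇒nonZero p-prime

  -- Euclid's lemma strips one factor `p` at a time until `d` divides 1.
  coprime-∣^⇒≡1 : ∀ {d} → Coprime d p → ∀ k → d ∣ p ^ k → d ≡ 1
  coprime-∣^⇒≡1 coprime zero    d∣1   = ∣1⇒≡1 d∣1
  coprime-∣^⇒≡1 coprime (suc k) d∣p^k = coprime-∣^⇒≡1 coprime k (coprime-divisor coprime d∣p^k)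

  ∤⇒coprime : ∀ {d} → ¬ p ∣ d → Coprime d p
  ∤⇒coprime p∤d (i∣d , i∣p) with prime⇒irreducible p-prime i∣p
  ... | inj₁ i≡1  = i≡1
  ... | inj₂ refl = contradiction i∣d p∤d

  ∣^⇒≡1⊎p∣ : ∀ {d} k → d ∣ p ^ k → d ≡ 1 ⊎ p ∣ d
  ∣^⇒≡1⊎p∣ {d} k d∣p^k with p ∣? d
  ... | yes p∣d = inj₂ p∣d
  ... | no  p∤d = inj₁ (coprime-∣^⇒≡1 (∤⇒coprime p∤d) k d∣p^k)

  scale : ℕ × ℕ → ℕ × ℕ
  scale (a , b) = p * a , p * b

  scale-injective : ∀ {x y} → scale x ≡ scale y → x ≡ y
  scale-injective eq = cong₂ _,_ (*-cancelˡ-≡ _ _ p (cong proj₁ eq)) (*-cancelˡ-≡ _ _ p (cong proj₂ eq))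

  -- `p` would be a common divisor, hence 1. This separates the two parts of `sortedGcdPairs`.
  ¬coprime-scale : ∀ {a b} → ¬ Coprime (p * a) (p * b)
  ¬coprime-scale {a} {b} coprime = ¬prime[1] (subst Prime (coprime (m∣m*n a , m∣m*n b)) p-prime)

  -- The list starts empty because the only pair modulo 1 is `(0 , 0)`. The `∸ 1` turns the strict
  -- bound on `b` into the inclusive bound of `coprimePairs`.
  sortedGcdPairs : ℕ → List (ℕ × ℕ)
  sortedGcdPairs zero    = []
  sortedGcdPairs (suc k) = coprimePairs (p ^ suc k ∸ 1) ++ map scale (sortedGcdPairs k)

  -- Since `p` is at least 2, the pair `(0 , 1)` lies within the bound at every positive exponent.
  1≤p^1+k∸1 : ∀ k → 1 ≤ p ^ suc k ∸ 1
  1≤p^1+k∸1 k = <⇒≤pred (<-≤-trans (nonTrivial⇒n>1 p {{prime⇒nonTrivial p-prime}})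
                                   (m≤m*n p (p ^ k) {{m^n≢0 p k}}))

  sortedGcdPairs-sound : ∀ k {x} → x ∈ sortedGcdPairs k → SortedGcdPair (p ^ k) x
  sortedGcdPairs-sound (suc k) x∈ with ∈-++⁻ (coprimePairs (p ^ suc k ∸ 1)) x∈
  ... | inj₁ x∈coprime
    with a≤b , b≤ , coprime ← ∈-coprimePairs⁻ (1≤p^1+k∸1 k) x∈coprime
    = a≤b , m≤pred[n]⇒suc[m]≤n {{m^n≢0 p (suc k)}} b≤
    , subst (_∣ p ^ suc k) (sym (coprime⇒gcd≡1 coprime)) (1∣ _)
  ... | inj₂ x∈scaled
    with (a , b) , y∈ , refl ← ∈-map⁻ scale x∈scaled
    with a≤b , b<p^k , g∣p^k ← sortedGcdPairs-sound k y∈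
    -- Scaling multiplies the entries, their gcd and the modulus by the same factor `p`.
    = *-monoʳ-≤ p a≤b , *-monoʳ-< p b<p^k
    , subst (_∣ p ^ suc k) (c*gcd[m,n]≡gcd[cm,cn] p a b) (*-monoʳ-∣ p g∣p^k)

  sortedGcdPairs-complete : ∀ k {x} → SortedGcdPair (p ^ k) x → x ∈ sortedGcdPairs k
  -- The bounds force the pair `(0 , 0)`, whose gcd 0 does not divide 1.
  sortedGcdPairs-complete zero (z≤n , s≤s z≤n , g∣1) with () ← ∣1⇒≡1 g∣1
  sortedGcdPairs-complete (suc k) {a , b} (a≤b , b<p^1+k , g∣p^1+k) with ∣^⇒≡1⊎p∣ (suc k) g∣p^1+k
  ... | inj₁ g≡1 = ∈-++⁺ˡ (∈-coprimePairs⁺ a≤b (<⇒≤pred b<p^1+k) (gcd≡1⇒coprime g≡1))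
  ... | inj₂ p∣g = ∈-++⁺ʳ (coprimePairs (p ^ suc k ∸ 1))
      (descend (∣-trans p∣g (gcd[m,n]∣m a b)) (∣-trans p∣g (gcd[m,n]∣n a b)))
    where
    descend : p ∣ a → p ∣ b → (a , b) ∈ map scale (sortedGcdPairs k)
    descend (divides c a≡cp) (divides d b≡dp)
      -- Once `a` and `b` are rewritten as `p * c` and `p * d`, the factor `p` cancels from the
      -- order, the bound and the divisibility.
      with refl ← trans a≡cp (*-comm c p)
      with refl ← trans b≡dp (*-comm d p)
      = ∈-map⁺ scale (sortedGcdPairs-complete k
          ( *-cancelˡ-≤ p a≤b
          , *-cancelˡ-< p d (p ^ k) b<p^1+k
          , *-cancelˡ-∣ p (subst (_∣ p ^ suc k) (sym (c*gcd[m,n]≡gcd[cm,cn] p c d)) g∣p^1+k) ))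

  sortedGcdPairs-unique : ∀ k → Unique (sortedGcdPairs k)
  sortedGcdPairs-unique zero    = []
  sortedGcdPairs-unique (suc k) =
    Unique.++⁺ (coprimePairs-unique (p ^ suc k ∸ 1)) (Unique.map⁺ scale-injective (sortedGcdPairs-unique k)) disjoint
    where
    disjoint : Disjoint (coprimePairs (p ^ suc k ∸ 1)) (map scale (sortedGcdPairs k))
    disjoint (x∈coprime , x∈scaled)
      with _ , _ , refl ← ∈-map⁻ scale x∈scaled
      with _ , _ , coprime ← ∈-coprimePairs⁻ (1≤p^1+k∸1 k) x∈coprime
      = ¬coprime-scale coprime

  -- Each exponent contributes one pair `(0 , 1)`, which gives the summand `k`; its positive coprime
  -- pairs give the new term of the sum.
  length-sortedGcdPairs : ∀ k → length (sortedGcdPairs k) ≡ k + ∑[1⋯ k ] (λ i → ∑[1⋯ p ^ i ∸ 1 ] φ)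
  length-sortedGcdPairs zero    = refl
  length-sortedGcdPairs (suc k) = begin
    length (coprimePairs (p ^ suc k ∸ 1) ++ map scale (sortedGcdPairs k))
      ≡⟨ length-++ (coprimePairs (p ^ suc k ∸ 1)) ⟩
    length (coprimePairs (p ^ suc k ∸ 1)) + length (map scale (sortedGcdPairs k))
      ≡⟨ cong₂ _+_ (length-coprimePairs (p ^ suc k ∸ 1))
                   (trans (length-map scale (sortedGcdPairs k)) (length-sortedGcdPairs k)) ⟩
    suc (s (suc k)) + (k + ∑[1⋯ k ] s)
      ≡⟨ +-comm (suc (s (suc k))) _ ⟩
    (k + ∑[1⋯ k ] s) + suc (s (suc k))
      ≡⟨ +-suc _ _ ⟩
    suc ((k + ∑[1⋯ k ] s) + s (suc k))
      ≡⟨ cong suc (+-assoc k _ _) ⟩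
    suc k + (∑[1⋯ k ] s + s (suc k))
      ≡⟨ cong (suc k +_) (∑-snoc s k) ⟨
    suc k + ∑[1⋯ suc k ] s
      ∎
    where
    open ≡-Reasoning
    s : ℕ → ℕ
    s i = ∑[1⋯ p ^ i ∸ 1 ] φ

  ν-prime-power-cardinality : ∀ k →
    HasCardinality (ν (p ^ k)) (k + ∑[1⋯ k ] (λ i → ∑[1⋯ p ^ i ∸ 1 ] φ))
  ν-prime-power-cardinality k = subst (HasCardinality (ν (p ^ k))) (length-sortedGcdPairs k)
    (ν-cardinality (p ^ k) (sortedGcdPairs-unique k) (sortedGcdPairs-complete k) (sortedGcdPairs-sound k))

theorem3p1 : ∀ (p : ℕ) → Prime p →
    (∀ (k : ℕ) → 1 ≤ k →
    HasCardinality (ν (p ^ k)) (k + ∑[1⋯ k ] (λ i → ∑[1⋯ p ^ i ∸ 1 ] φ)))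
    × HasCardinality (ν p) (1 + ∑[1⋯ p ∸ 1 ] φ)
theorem3p1 p p-prime =
    (λ k _ → ν-prime-power-cardinality p-prime k)
  -- For exponent 1 the outer sum unfolds to its single term plus 0; removing that 0 and rewriting
  -- `p ^ 1` as `p` gives the special case.
  , subst (λ q → HasCardinality (ν q) (1 + ∑[1⋯ q ∸ 1 ] φ)) (^-identityʳ p)
      (subst (λ s → HasCardinality (ν (p ^ 1)) (1 + s)) (+-identityʳ _)
        (ν-prime-power-cardinality p-prime 1))
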